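{- A word $p\in\{0,1\}^*$ is a binary pattern encountered by the period-doubling word $\mathbf{d}$ if and only if one of the following holds: 1. For at least one $q\in\{p,\overline{p}\}$, at least one of the words $q$, $h_1(q)$, $h_2(q)$ is a factor of $\mathbf{d}$. 2. One of $p$ and $\overline{p}$ is among $0010100$, $01001001000$, $00100100100$, $001001001000$, $00010010010$, $000100100100$, $0010001000100$, $00100010001000$, $00010001000100$, and $000100010001000$. The two possibilities are mutually exclusive.
   Context: The period-doubling word $\mathbf{d}=01000101010001000100010101000101\cdots$ is the one-sided infinite fixed point, beginning with $0$, of the morphism $\delta$ with $\delta(0)=01$, $\delta(1)=00$. A factor of a word is a finite contiguous subword. A word $w$ encounters a binary pattern $p\in\{0,1\}^*$ if $g(p)$ is a factor of $w$ for some non-erasing morphism $g:\{0,1\}^*\to\{0,1\}^*$ (i.e. $g(0),g(1)$ non-empty). $\overline{p}$ is the binary complement of $p$ (exchange $0$ and $1$). The morphisms $h_1,h_2$ are $h_1(0)=0$, $h_1(1)=01$ and $h_2(0)=0$, $h_2(1)=10$. -}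

module Defs where

open import Data.Bool.Base using (Bool; true; false; not)
open import Data.Fin.Base using (Fin; zero; suc; toℕ; fromℕ<)
open import Data.Fin.Properties using (toℕ-fromℕ<)
open import Data.List.Base
  using (List; []; _∷_; [_]; _++_; map; concatMap; length; lookup; applyUpTo)
open import Data.List.Membership.Propositional using (_∈_)
open import Data.List.Properties
  using (∷-injective; concatMap-++; ++-assoc; ++-identityʳ)
open import Data.List.Relation.Unary.Any using (Any)
open import Data.Nat.Base using (ℕ; zero; suc; _+_; _∸_; _≤_; _<_; z≤n; s≤s; z<s)
open import Data.Nat.GeneralisedArithmetic using (fold)
open import Data.Nat.Properties
  using (≤-trans; ≤-total; <⇒≤; m∸n+n≡m; +-suc; +-mono-≤; module ≤-Reasoning)
open import Data.Product.Base using (∃-syntax; _×_; _,_)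
open import Data.Sum.Base using (_⊎_; inj₁; inj₂)
open import Relation.Binary.PropositionalEquality
  using (_≡_; _≢_; refl; sym; trans; cong; cong₂; subst)

Letter : Set
Letter = Bool

pattern 𝟎 = false
pattern 𝟏 = true

Word : Set
Word = List Letter

InfiniteWord : Set
InfiniteWord = ℕ → Letter

complement : Word → Word
complement = map not

-- A morphism {0,1}* → {0,1}* is given by its values on the letters.
Morphism : Set
Morphism = Letter → Word

infix 10 _⟨_⟩

_⟨_⟩ : Morphism → Word → Word
g ⟨ w ⟩ = concatMap g w

NonErasing : Morphism → Set
NonErasing g = ∀ a → g a ≢ []

prefix : InfiniteWord → ℕ → Word
prefix = applyUpTo

IsFactor : Word → InfiniteWord → Set
IsFactor u w = ∃[ i ] prefix (λ j → w (i + j)) (length u) ≡ u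

Encounters : InfiniteWord → Word → Set
Encounters w p = ∃[ g ] NonErasing g × IsFactor (g ⟨ p ⟩) w

-- w = g(w) for an infinite word w: the image of every finite prefix of w is
-- again a prefix of w.  This determines g(w) = w only when g(w) is infinite,
-- in particular for non-erasing g.
IsFixedPoint : Morphism → InfiniteWord → Set
IsFixedPoint g w = ∀ n → prefix w (length (g ⟨ prefix w n ⟩)) ≡ g ⟨ prefix w n ⟩

δ : Morphism
δ 𝟎 = 𝟎 ∷ 𝟏 ∷ []
δ 𝟏 = 𝟎 ∷ 𝟎 ∷ []

δ^_[0] : ℕ → Word
δ^ n [0] = fold [ 𝟎 ] (δ ⟨_⟩) n

length-δ : ∀ w → length (δ ⟨ w ⟩) ≡ length w + length w
length-δ []      = refl
length-δ (𝟎 ∷ w) = cong suc (trans (cong suc (length-δ w)) (sym (+-suc _ _)))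
length-δ (𝟏 ∷ w) = cong suc (trans (cong suc (length-δ w)) (sym (+-suc _ _)))

n<length-δ^n : ∀ n → n < length (δ^ n [0])
n<length-δ^n zero    = z<s
n<length-δ^n (suc n) = begin
  suc (suc n)                              ≤⟨ +-mono-≤ (≤-trans (s≤s z≤n) ih) ih ⟩
  length (δ^ n [0]) + length (δ^ n [0])    ≡⟨ length-δ (δ^ n [0]) ⟨
  length (δ^ suc n [0])                    ∎
  where
  open ≤-Reasoning
  ih = n<length-δ^n n

-- The period-doubling word, as the limit of the words δⁿ(0).  By 𝐝-head,
-- 𝐝-fixed and 𝐝-unique below it is the unique fixed point of δ beginning
-- with 0.
𝐝 : InfiniteWord
𝐝 n = lookup (δ^ n [0]) (fromℕ< (n<length-δ^n n))

h₁ h₂ : Morphism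
h₁ 𝟎 = [ 𝟎 ]
h₁ 𝟏 = 𝟎 ∷ 𝟏 ∷ []
h₂ 𝟎 = [ 𝟎 ]
h₂ 𝟏 = 𝟏 ∷ 𝟎 ∷ []

FactorCondition : Word → Set
FactorCondition q = IsFactor q 𝐝 ⊎ IsFactor (h₁ ⟨ q ⟩) 𝐝 ⊎ IsFactor (h₂ ⟨ q ⟩) 𝐝

exceptionalWords : List Word
exceptionalWords
  = (𝟎 ∷ 𝟎 ∷ 𝟏 ∷ 𝟎 ∷ 𝟏 ∷ 𝟎 ∷ 𝟎 ∷ [])
  ∷ (𝟎 ∷ 𝟏 ∷ 𝟎 ∷ 𝟎 ∷ 𝟏 ∷ 𝟎 ∷ 𝟎 ∷ 𝟏 ∷ 𝟎 ∷ 𝟎 ∷ 𝟎 ∷ [])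
  ∷ (𝟎 ∷ 𝟎 ∷ 𝟏 ∷ 𝟎 ∷ 𝟎 ∷ 𝟏 ∷ 𝟎 ∷ 𝟎 ∷ 𝟏 ∷ 𝟎 ∷ 𝟎 ∷ [])
  ∷ (𝟎 ∷ 𝟎 ∷ 𝟏 ∷ 𝟎 ∷ 𝟎 ∷ 𝟏 ∷ 𝟎 ∷ 𝟎 ∷ 𝟏 ∷ 𝟎 ∷ 𝟎 ∷ 𝟎 ∷ [])
  ∷ (𝟎 ∷ 𝟎 ∷ 𝟎 ∷ 𝟏 ∷ 𝟎 ∷ 𝟎 ∷ 𝟏 ∷ 𝟎 ∷ 𝟎 ∷ 𝟏 ∷ 𝟎 ∷ [])
  ∷ (𝟎 ∷ 𝟎 ∷ 𝟎 ∷ 𝟏 ∷ 𝟎 ∷ 𝟎 ∷ 𝟏 ∷ 𝟎 ∷ 𝟎 ∷ 𝟏 ∷ 𝟎 ∷ 𝟎 ∷ [])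
  ∷ (𝟎 ∷ 𝟎 ∷ 𝟏 ∷ 𝟎 ∷ 𝟎 ∷ 𝟎 ∷ 𝟏 ∷ 𝟎 ∷ 𝟎 ∷ 𝟎 ∷ 𝟏 ∷ 𝟎 ∷ 𝟎 ∷ [])
  ∷ (𝟎 ∷ 𝟎 ∷ 𝟏 ∷ 𝟎 ∷ 𝟎 ∷ 𝟎 ∷ 𝟏 ∷ 𝟎 ∷ 𝟎 ∷ 𝟎 ∷ 𝟏 ∷ 𝟎 ∷ 𝟎 ∷ 𝟎 ∷ [])
  ∷ (𝟎 ∷ 𝟎 ∷ 𝟎 ∷ 𝟏 ∷ 𝟎 ∷ 𝟎 ∷ 𝟎 ∷ 𝟏 ∷ 𝟎 ∷ 𝟎 ∷ 𝟎 ∷ 𝟏 ∷ 𝟎 ∷ 𝟎 ∷ [])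
  ∷ (𝟎 ∷ 𝟎 ∷ 𝟎 ∷ 𝟏 ∷ 𝟎 ∷ 𝟎 ∷ 𝟎 ∷ 𝟏 ∷ 𝟎 ∷ 𝟎 ∷ 𝟎 ∷ 𝟏 ∷ 𝟎 ∷ 𝟎 ∷ 𝟎 ∷ [])
  ∷ []

Possibility₁ Possibility₂ : Word → Set
Possibility₁ p = Any FactorCondition (p ∷ complement p ∷ [])
Possibility₂ p = Any (_∈ exceptionalWords) (p ∷ complement p ∷ [])

IsPrefix : Word → InfiniteWord → Set
IsPrefix u w = prefix w (length u) ≡ u

lookup⇒prefix : ∀ w u → (∀ j → w (toℕ j) ≡ lookup u j) → IsPrefix u w
lookup⇒prefix w []      eq = refl
lookup⇒prefix w (a ∷ u) eq =
  cong₂ _∷_ (eq zero) (lookup⇒prefix (λ n → w (suc n)) u (λ j → eq (suc j)))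

prefix⇒lookup : ∀ w u → IsPrefix u w → ∀ j → w (toℕ j) ≡ lookup u j
prefix⇒lookup w (a ∷ u) eq j with ∷-injective eq
prefix⇒lookup w (a ∷ u) eq zero    | eq₀ , _ = eq₀
prefix⇒lookup w (a ∷ u) eq (suc j) | _ , eq₁ = prefix⇒lookup (λ n → w (suc n)) u eq₁ j

prefix-++ : ∀ w u v → IsPrefix (u ++ v) w → IsPrefix u w
prefix-++ w []      v eq = refl
prefix-++ w (a ∷ u) v eq with ∷-injective eq
... | eq₀ , eq₁ = cong₂ _∷_ eq₀ (prefix-++ (λ n → w (suc n)) u v eq₁)

prefix-≤ : ∀ w {m n} → m ≤ n → ∃[ v ] prefix w n ≡ prefix w m ++ v
prefix-≤ w z≤n       = _ , refl
prefix-≤ w (s≤s m≤n) with prefix-≤ (λ n → w (suc n)) m≤n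
... | v , eq = v , cong (w 0 ∷_) eq

δ^-step : ∀ n → ∃[ v ] δ^ suc n [0] ≡ δ^ n [0] ++ v
δ^-step zero    = [ 𝟏 ] , refl
δ^-step (suc n) with δ^-step n
... | v , eq = δ ⟨ v ⟩ , trans (cong (δ ⟨_⟩) eq) (concatMap-++ δ (δ^ n [0]) v)

δ^-+ : ∀ k n → ∃[ v ] δ^ (k + n) [0] ≡ δ^ n [0] ++ v
δ^-+ zero    n = [] , sym (++-identityʳ _)
δ^-+ (suc k) n with δ^-+ k n | δ^-step (k + n)
... | v , eq | v′ , eq′ = v ++ v′ , trans eq′ (trans (cong (_++ v′) eq) (++-assoc (δ^ n [0]) v v′))

δ^-≤ : ∀ {m n} → m ≤ n → ∃[ v ] δ^ n [0] ≡ δ^ m [0] ++ v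
δ^-≤ {m} {n} m≤n with δ^-+ (n ∸ m) m
... | v , eq = v , trans (cong δ^_[0] (sym (m∸n+n≡m m≤n))) eq

lookup-prefix : ∀ (u v : Word) {x : Word} → x ≡ u ++ v → ∀ (i : Fin (length u)) (j : Fin (length x)) →
                toℕ i ≡ toℕ j → lookup u i ≡ lookup x j
lookup-prefix (a ∷ u) v refl zero    zero    _  = refl
lookup-prefix (a ∷ u) v refl (suc i) (suc j) eq =
  lookup-prefix u v refl i j (cong (_∸ 1) eq)

δ^-lookup : ∀ m n (i : Fin (length (δ^ m [0]))) (j : Fin (length (δ^ n [0]))) →
            toℕ i ≡ toℕ j → lookup (δ^ m [0]) i ≡ lookup (δ^ n [0]) j
δ^-lookup m n i j eq with ≤-total m n
... | inj₁ m≤n with δ^-≤ m≤n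
...   | v , eq′ = lookup-prefix (δ^ m [0]) v eq′ i j eq
δ^-lookup m n i j eq | inj₂ n≤m with δ^-≤ n≤m
...   | v , eq′ = sym (lookup-prefix (δ^ n [0]) v eq′ j i (sym eq))

δ^-prefix : ∀ n → IsPrefix (δ^ n [0]) 𝐝
δ^-prefix n = lookup⇒prefix 𝐝 (δ^ n [0]) λ j →
  δ^-lookup (toℕ j) n _ j (toℕ-fromℕ< (n<length-δ^n (toℕ j)))

𝐝-head : 𝐝 0 ≡ 𝟎
𝐝-head = refl

𝐝-fixed : IsFixedPoint δ 𝐝
𝐝-fixed n with prefix-≤ 𝐝 (<⇒≤ (n<length-δ^n n))
... | v , eq = prefix-++ 𝐝 (δ ⟨ prefix 𝐝 n ⟩) (δ ⟨ v ⟩)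
                 (subst (λ u → IsPrefix u 𝐝) image (δ^-prefix (suc n)))
  where
  image : δ^ suc n [0] ≡ δ ⟨ prefix 𝐝 n ⟩ ++ δ ⟨ v ⟩
  image = trans (cong (δ ⟨_⟩) (trans (sym (δ^-prefix n)) eq))
                (concatMap-++ δ (prefix 𝐝 n) v)

𝐝-unique : ∀ w → w 0 ≡ 𝟎 → IsFixedPoint δ w → ∀ n → w n ≡ 𝐝 n
𝐝-unique w head fixed n =
  trans (cong w (sym (toℕ-fromℕ< (n<length-δ^n n))))
        (prefix⇒lookup w (δ^ n [0]) (δ^-isPrefix n) (fromℕ< (n<length-δ^n n)))
  where
  δ^-isPrefix : ∀ m → IsPrefix (δ^ m [0]) w
  δ^-isPrefix zero    = cong [_] head
  δ^-isPrefix (suc m) =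
    subst (λ u → IsPrefix (δ ⟨ u ⟩) w) (δ^-isPrefix m) (fixed (length (δ^ m [0])))

{-# OPTIONS --safe #-}

-- Since 𝐝(2n) = 0 and 𝐝(2n+1) is the complement of 𝐝(n), factors of 𝐝 can be
-- desubstituted, and every factor other than ε, 0 and 00 occurs at positions
-- of one parity only.  In particular a square of odd period is 00, and 𝐝 has
-- no fourth powers.  If both images of g have even length, then desubstituting
-- g(p) gives an encounter of the same pattern by shorter images.  Otherwise,
-- up to complement, |g(0)| is odd.  If neither image is 0, then p avoids a few
-- short words, which leaves finitely many p.  If g(0) = 0, then the positions
-- of g(1) all have one parity; unless it forces finitely many p, desubstituting
-- g(p) amounts to reading p as the image of a word q under 0 ↦ 00, 1 ↦ c (c = 1 or 01),
-- up to letters at the ends, where q is encountered by a morphism sending 0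
-- to 1.  Again there are finitely many q, except when g(1) is 1, 01 or 10,
-- which are the three morphisms of the first possibility.
module Submission where

open import Defs
open import Data.Bool.Base using (Bool; false; not; _∧_; _∨_; T)
open import Data.Bool.Properties using (T-∧; T-∨; T?; not-involutive; _≟_)
open import Data.Fin.Base using (zero)
open import Data.List.Base using (List; []; _∷_; [_]; _++_; map; length; drop; foldr; _ʳ++_; reverse)
open import Data.List.Membership.Propositional using (_∈_)
open import Data.List.Properties
  using (++-identityʳ; ++-assoc; length-++; ∷-injective; concatMap-++; concatMap-cong; concatMap-map;
         concatMap-pure; map-id; map-cong; map-∘; ʳ++-defn; reverse-involutive; ≡-dec)
open import Data.List.Relation.Binary.Infix.Heterogeneous using (Infix; View; MkView; toView)
open import Data.List.Relation.Binary.Infix.Heterogeneous.Properties using (infix?)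
open import Data.List.Relation.Binary.Pointwise using (Pointwise-≡⇒≡)
import Data.List.Relation.Binary.Prefix.Heterogeneous as Prefix
open import Data.List.Relation.Binary.Prefix.Heterogeneous.Properties using (prefix?)
open import Data.List.Relation.Unary.All as All using (All; []; _∷_)
open import Data.List.Relation.Unary.Any as Any using (Any; here; there; any?)
open import Data.Nat.Base using (ℕ; zero; suc; _+_; _*_; _≤_; _<_; z≤n; s≤s; s<s; s≤s⁻¹; parity)
open import Data.Nat.Properties using (≤-refl; ≤-trans; m≤n⇒m≤1+n; +-suc; +-comm)
open import Data.Parity.Base using (Parity; 0ℙ; 1ℙ; _⁻¹) renaming (_+_ to _⊕_)
open import Data.Parity.Properties using (+-homo-+)
open import Data.Product.Base using (∃-syntax; _×_; _,_; proj₁; proj₂)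
open import Data.Sum.Base using (_⊎_; inj₁; inj₂; [_,_]′) renaming (map to map-⊎)
open import Data.Unit.Base using (⊤; tt)
open import Function.Base using (_∘_)
open import Function.Bundles using (_⇔_; mk⇔; Equivalence)
open import Relation.Binary.PropositionalEquality
  using (_≡_; _≢_; _≗_; refl; sym; trans; cong; cong₂; subst)
open import Relation.Nullary.Decidable
  using (Dec; isYes; yes; no; toWitness; True; _⊎-dec_; _×-dec_; ¬?)
open import Relation.Nullary.Negation.Core using (¬_; contradiction)

private variable
  u v w : Word
  π : Parity

-- The letters of 𝐝

-- The word and its preimage are kept apart as `w` and `v` because the induction shifts `w` by two
-- letters while it shifts `v` by one.
δ-preimage : ∀ w v m → IsPrefix (δ ⟨ prefix v m ⟩) w →
             ∀ {k} → k < m → w (k * 2) ≡ 𝟎 × w (suc (k * 2)) ≡ not (v k)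
δ-preimage w v (suc m) eq k<m with subst (λ u → IsPrefix u w) (δ-∷ (v 0) (prefix (v ∘ suc) m)) eq
  where
  δ-∷ : ∀ a u → δ ⟨ a ∷ u ⟩ ≡ 𝟎 ∷ not a ∷ δ ⟨ u ⟩
  δ-∷ 𝟎 u = refl
  δ-∷ 𝟏 u = refl
δ-preimage w v (suc m) eq {zero}  k<m       | eq′ =
  proj₁ (∷-injective eq′) , proj₁ (∷-injective (proj₂ (∷-injective eq′)))
δ-preimage w v (suc m) eq {suc k} (s<s k<m) | eq′ =
  δ-preimage (w ∘ suc ∘ suc) (v ∘ suc) m (cong (drop 2) eq′) k<m

𝐝-even : ∀ n → 𝐝 (n * 2) ≡ 𝟎
𝐝-even n = proj₁ (δ-preimage 𝐝 𝐝 (suc n) (𝐝-fixed (suc n)) ≤-refl)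

𝐝-odd : ∀ n → 𝐝 (suc (n * 2)) ≡ not (𝐝 n)
𝐝-odd n = proj₂ (δ-preimage 𝐝 𝐝 (suc n) (𝐝-fixed (suc n)) ≤-refl)

𝐝-odd⁻¹ : ∀ n {a} → 𝐝 (suc (n * 2)) ≡ a → 𝐝 n ≡ not a
𝐝-odd⁻¹ n e = trans (sym (not-involutive _)) (cong not (trans (sym (𝐝-odd n)) e))

-- Occurrences

OccursAt : ℕ → Word → Set
OccursAt i []      = ⊤
OccursAt i (a ∷ u) = 𝐝 i ≡ a × OccursAt (suc i) u

position : Parity → ℕ → ℕ
position 0ℙ n = n * 2
position 1ℙ n = suc (n * 2)

-- The index counts blocks of `δ`, so it is also the position that the occurrence takes after
-- desubstitution.
record Occurs (π : Parity) (u : Word) : Set where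
  constructor at
  field
    index    : ℕ
    occursAt : OccursAt (position π index) u

Factor : Word → Set
Factor u = ∃[ π ] Occurs π u

position-surjective : ∀ i → ∃[ π ] ∃[ n ] position π n ≡ i
position-surjective zero    = 0ℙ , 0 , refl
position-surjective (suc i) with position-surjective i
... | 0ℙ , n , refl = 1ℙ , n , refl
... | 1ℙ , n , refl = 0ℙ , suc n , refl

OccursAt⇒Factor : ∀ i → OccursAt i u → Factor u
OccursAt⇒Factor {u} i o with position-surjective i
... | π , n , eq = π , at n (subst (λ j → OccursAt j u) (sym eq) o)

IsPrefix⇒OccursAt : ∀ w i u → (∀ j → w j ≡ 𝐝 (j + i)) → IsPrefix u w → OccursAt i u
IsPrefix⇒OccursAt w i []      shift eq = tt
IsPrefix⇒OccursAt w i (a ∷ u) shift eq =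
  trans (sym (shift 0)) (prefix⇒lookup w (a ∷ u) eq zero) ,
  IsPrefix⇒OccursAt (w ∘ suc) (suc i) u (λ j → trans (shift (suc j)) (cong 𝐝 (sym (+-suc j i))))
    (cong (drop 1) eq)

OccursAt⇒IsPrefix : ∀ w i u → (∀ j → w j ≡ 𝐝 (j + i)) → OccursAt i u → IsPrefix u w
OccursAt⇒IsPrefix w i []      shift o       = refl
OccursAt⇒IsPrefix w i (a ∷ u) shift (e , o) = cong₂ _∷_ (trans (shift 0) e)
  (OccursAt⇒IsPrefix (w ∘ suc) (suc i) u (λ j → trans (shift (suc j)) (cong 𝐝 (sym (+-suc j i)))) o)

IsFactor⇒Factor : ∀ u → IsFactor u 𝐝 → Factor u
IsFactor⇒Factor u (i , eq) =
  OccursAt⇒Factor i (IsPrefix⇒OccursAt _ i u (λ j → cong 𝐝 (+-comm i j)) eq)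

Factor⇒IsFactor : ∀ u → Factor u → IsFactor u 𝐝
Factor⇒IsFactor u (π , at n o) =
  position π n , OccursAt⇒IsPrefix _ _ u (λ j → cong 𝐝 (+-comm (position π n) j)) o

∥_∥ : Word → Parity
∥ u ∥ = parity (length u)

∥++∥ : ∀ u v → ∥ u ++ v ∥ ≡ ∥ u ∥ ⊕ ∥ v ∥
∥++∥ u v = trans (cong parity (length-++ u)) (+-homo-+ (length u) (length v))

-- This evaluates on a closed pattern once the two parities are known, so that later side conditions
-- on lengths hold by `refl`.
imageParity : Parity → Parity → Word → Parity
imageParity σ τ = foldr (λ { 𝟎 → σ ⊕_ ; 𝟏 → τ ⊕_ }) 0ℙ

∥⟨⟩∥ : ∀ (g : Morphism) {σ τ} → ∥ g 𝟎 ∥ ≡ σ → ∥ g 𝟏 ∥ ≡ τ →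
       ∀ u → ∥ g ⟨ u ⟩ ∥ ≡ imageParity σ τ u
∥⟨⟩∥ g eq₀ eq₁ []      = refl
∥⟨⟩∥ g eq₀ eq₁ (𝟎 ∷ u) = trans (∥++∥ (g 𝟎) (g ⟨ u ⟩)) (cong₂ _⊕_ eq₀ (∥⟨⟩∥ g eq₀ eq₁ u))
∥⟨⟩∥ g eq₀ eq₁ (𝟏 ∷ u) = trans (∥++∥ (g 𝟏) (g ⟨ u ⟩)) (cong₂ _⊕_ eq₁ (∥⟨⟩∥ g eq₀ eq₁ u))

Occurs-tail : ∀ {a} → Occurs π (a ∷ u) → Occurs (π ⁻¹) u
Occurs-tail {0ℙ} (at n (_ , o)) = at n o
Occurs-tail {1ℙ} (at n (_ , o)) = at (suc n) o

Occurs-++ˡ : ∀ u → Occurs π (u ++ v) → Occurs π u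
Occurs-++ˡ {π} {v} u (at n o) = at n (go _ u o)
  where
  go : ∀ i u → OccursAt i (u ++ v) → OccursAt i u
  go i []      o       = tt
  go i (a ∷ u) (e , o) = e , go (suc i) u o

Occurs-++ʳ : ∀ u → Occurs π (u ++ v) → Occurs (∥ u ∥ ⊕ π) v
Occurs-++ʳ []          o = o
Occurs-++ʳ (a ∷ [])    o = Occurs-tail o
Occurs-++ʳ {0ℙ} (a ∷ b ∷ u) o = Occurs-++ʳ u (Occurs-tail (Occurs-tail o))
Occurs-++ʳ {1ℙ} (a ∷ b ∷ u) o = Occurs-++ʳ u (Occurs-tail (Occurs-tail o))

Factor-++ˡ : ∀ u → Factor (u ++ v) → Factor u
Factor-++ˡ u (π , o) = π , Occurs-++ˡ u o

Factor-++ʳ : ∀ u → Factor (u ++ v) → Factor v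
Factor-++ʳ u (π , o) = _ , Occurs-++ʳ u o

Occurs-0∷ : Occurs 1ℙ u → Occurs 0ℙ (𝟎 ∷ u)
Occurs-0∷ (at n o) = at n (𝐝-even n , o)

¬Occurs-even-1∷ : ¬ Occurs 0ℙ (𝟏 ∷ u)
¬Occurs-even-1∷ (at n (e , _)) with () ← trans (sym (𝐝-even n)) e

-- Desubstitution

-- At odd parity a last unpaired letter still determines a letter of the preimage.
half : Parity → Word → Word
half π  (a ∷ b ∷ u) = letter π ∷ half π u
  where
  letter : Parity → Letter
  letter 0ℙ = not b
  letter 1ℙ = not a
half 1ℙ (a ∷ [])    = not a ∷ []
half _  _           = []

-- Each pair of letters meets one odd position 2n + 1, in its second letter at even parity and in
-- its first at odd parity; that letter is the complement of the letter of 𝐝 at n.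
OccursAt-half : ∀ π n u → OccursAt (position π n) u → OccursAt n (half π u)
OccursAt-half 0ℙ n []          o           = tt
OccursAt-half 0ℙ n (a ∷ [])    o           = tt
OccursAt-half 0ℙ n (a ∷ b ∷ u) (_ , e , o) =
  𝐝-odd⁻¹ n e , OccursAt-half 0ℙ (suc n) u o
OccursAt-half 1ℙ n []          o           = tt
OccursAt-half 1ℙ n (a ∷ [])    (e , o)     =
  𝐝-odd⁻¹ n e , tt
OccursAt-half 1ℙ n (a ∷ b ∷ u) (e , _ , o) =
  𝐝-odd⁻¹ n e , OccursAt-half 1ℙ (suc n) u o

Occurs-half : ∀ u → Occurs π u → Factor (half π u)
Occurs-half {π} u (at n o) = OccursAt⇒Factor n (OccursAt-half π n u o)

half-++ : ∀ π u v → ∥ u ∥ ≡ 0ℙ → half π (u ++ v) ≡ half π u ++ half π v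
half-++ π []          v even = refl
half-++ π (a ∷ b ∷ u) v even = cong (_ ∷_) (half-++ π u v even)

half-⟨⟩ : ∀ π (g : Morphism) → (∀ a → ∥ g a ∥ ≡ 0ℙ) →
          ∀ p → half π (g ⟨ p ⟩) ≡ (half π ∘ g) ⟨ p ⟩
half-⟨⟩ 0ℙ g even []      = refl
half-⟨⟩ 1ℙ g even []      = refl
half-⟨⟩ π  g even (a ∷ p) =
  trans (half-++ π (g a) (g ⟨ p ⟩) (even a)) (cong (half π (g a) ++_) (half-⟨⟩ π g even p))

half-≢[] : ∀ π u → ∥ u ∥ ≡ 0ℙ → u ≢ [] → half π u ≢ []
half-≢[] π []          even ≢ _  = ≢ refl
half-≢[] π (a ∷ b ∷ u) even ≢ ()

length-half-≤ : ∀ π u → length (half π u) ≤ length u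
length-half-≤ 0ℙ []          = z≤n
length-half-≤ 1ℙ []          = z≤n
length-half-≤ 0ℙ (a ∷ [])    = z≤n
length-half-≤ 1ℙ (a ∷ [])    = s≤s z≤n
length-half-≤ π  (a ∷ b ∷ u) = s≤s (m≤n⇒m≤1+n (length-half-≤ π u))

length-half-< : ∀ π u → ∥ u ∥ ≡ 0ℙ → u ≢ [] → length (half π u) < length u
length-half-< π []          even ≢ = contradiction refl ≢
length-half-< π (a ∷ b ∷ u) even ≢ = s≤s (s≤s (length-half-≤ π u))

illegal : Parity → Word → Bool
illegal _  []      = false
illegal 0ℙ (a ∷ u) = a ∨ illegal 1ℙ u
illegal 1ℙ (a ∷ u) = illegal 0ℙ u

-- The first argument bounds the number of desubstitutions.
absent : ℕ → Word → Bool
absent zero    u = false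
absent (suc k) u =
  (illegal 0ℙ u ∨ absent k (half 0ℙ u)) ∧ (illegal 1ℙ u ∨ absent k (half 1ℙ u))

illegal⇒¬Occurs : ∀ π u → T (illegal π u) → ¬ Occurs π u
illegal⇒¬Occurs 0ℙ (𝟎 ∷ u) t o = illegal⇒¬Occurs 1ℙ u t (Occurs-tail o)
illegal⇒¬Occurs 0ℙ (𝟏 ∷ u) t o = ¬Occurs-even-1∷ o
illegal⇒¬Occurs 1ℙ (a ∷ u) t o = illegal⇒¬Occurs 0ℙ u t (Occurs-tail o)

absent⇒¬Factor : ∀ k u → T (absent k u) → ¬ Factor u
absent⇒¬Factor (suc k) u t (π , o) with Equivalence.to T-∨ (choose π)
  where
  choose : ∀ π → T (illegal π u ∨ absent k (half π u))
  choose 0ℙ = proj₁ (Equivalence.to T-∧ t)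
  choose 1ℙ = proj₂ (Equivalence.to T-∧ t)
... | inj₁ i = illegal⇒¬Occurs π u i o
... | inj₂ a = absent⇒¬Factor k (half π u) a (Occurs-half u o)

¬Factor-0000 : ¬ Factor (𝟎 ∷ 𝟎 ∷ 𝟎 ∷ 𝟎 ∷ [])
¬Factor-0000 = absent⇒¬Factor 2 _ tt

-- Repetitions

-- The outer two 0s stand at odd positions and desubstitute to 11, which would put a 1 at an even
-- position in either alignment.
¬Occurs-odd-000 : ¬ Occurs 1ℙ (𝟎 ∷ 𝟎 ∷ 𝟎 ∷ u)
¬Occurs-odd-000 o = absent⇒¬Factor 1 _ tt (Occurs-half _ (Occurs-++ˡ (𝟎 ∷ 𝟎 ∷ 𝟎 ∷ []) o))

OneParity : Word → Set
OneParity u = ¬ Occurs 0ℙ u ⊎ ¬ Occurs 1ℙ u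

-- A 1 stands only at odd positions, so a 1 among the first three letters fixes the parity; a word
-- beginning with 000 cannot start at an odd position.
oneParity : ∀ u → u ≢ [] → u ≢ [ 𝟎 ] → u ≢ 𝟎 ∷ 𝟎 ∷ [] → OneParity u
oneParity []              ≢ε ≢0 ≢00 = contradiction refl ≢ε
oneParity (𝟎 ∷ [])        ≢ε ≢0 ≢00 = contradiction refl ≢0
oneParity (𝟎 ∷ 𝟎 ∷ [])    ≢ε ≢0 ≢00 = contradiction refl ≢00
oneParity (𝟏 ∷ u)         _ _ _ = inj₁ ¬Occurs-even-1∷
oneParity (𝟎 ∷ 𝟏 ∷ u)     _ _ _ = inj₂ (¬Occurs-even-1∷ ∘ Occurs-tail)
oneParity (𝟎 ∷ 𝟎 ∷ 𝟏 ∷ u) _ _ _ = inj₁ (¬Occurs-even-1∷ ∘ Occurs-tail ∘ Occurs-tail)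
oneParity (𝟎 ∷ 𝟎 ∷ 𝟎 ∷ u) _ _ _ = inj₂ ¬Occurs-odd-000

oneParity-odd : ∀ u → ∥ u ∥ ≡ 1ℙ → u ≢ [ 𝟎 ] → OneParity u
oneParity-odd u odd ≢0 = oneParity u (λ { refl → 0≢1 odd }) ≢0 (λ { refl → 0≢1 odd })
  where
  0≢1 : 0ℙ ≢ 1ℙ
  0≢1 ()

-- The two occurrences of `u` lie at an odd distance and hence have opposite parities.
¬odd-return : OneParity u → ∀ v → ∥ u ++ v ∥ ≡ 1ℙ → ¬ Factor (u ++ v ++ u)
¬odd-return {u} one v odd (π , o) = [ (λ ¬0 → ¬0 (proj₁ both)) , (λ ¬1 → ¬1 (proj₂ both)) ]′ one
  where
  first : Occurs π u
  first = Occurs-++ˡ u o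
  second : Occurs (π ⁻¹) u
  second = subst (λ ρ → Occurs (ρ ⊕ π) u) odd
             (Occurs-++ʳ (u ++ v) (subst (Occurs π) (sym (++-assoc u v u)) o))
  order : ∀ {π} → Occurs π u → Occurs (π ⁻¹) u → Occurs 0ℙ u × Occurs 1ℙ u
  order {0ℙ} o o′ = o , o′
  order {1ℙ} o o′ = o′ , o
  both = order first second

¬odd-square : ∀ u → ∥ u ∥ ≡ 1ℙ → u ≢ [ 𝟎 ] → ¬ Factor (u ++ u)
¬odd-square u odd ≢0 =
  ¬odd-return (oneParity-odd u odd ≢0) [] (trans (cong ∥_∥ (++-identityʳ u)) odd)

-- Descent on the length: desubstitution halves an even period, and an odd period contradicts
-- `¬odd-square` unless `u` is 0, which leaves 0000.
¬fourth-power : ∀ u → u ≢ [] → ¬ Factor (u ++ u ++ u ++ u)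
¬fourth-power u = bounded (length u) u ≤-refl
  where
  bounded : ∀ k u → length u ≤ k → u ≢ [] → ¬ Factor (u ++ u ++ u ++ u)
  bounded k       []       _       ≢ε _       = ≢ε refl
  bounded (suc k) u@(_ ∷ _) (s≤s ≤k) ≢ε (π , o) with ∥ u ∥ in eq
  ... | 0ℙ = bounded k (half π u) (≤-trans (s≤s⁻¹ (length-half-< π u eq ≢ε)) ≤k)
               (half-≢[] π u eq ≢ε)
               (subst Factor halves (Occurs-half (u ++ u ++ u ++ u) o))
    where
    halves : half π (u ++ u ++ u ++ u) ≡ half π u ++ half π u ++ half π u ++ half π u
    halves = trans (half-++ π u _ eq) (cong (half π u ++_)
            (trans (half-++ π u _ eq) (cong (half π u ++_) (half-++ π u u eq))))
  ... | 1ℙ with ≡-dec _≟_ u [ 𝟎 ]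
  ...   | yes refl = ¬Factor-0000 (π , o)
  ...   | no ≢0    =
    ¬odd-square u eq ≢0 (Factor-++ˡ (u ++ u) (π , subst (Occurs π) (sym (++-assoc u u (u ++ u))) o))

-- Searching the tree of words that avoid a set of factors

Avoids : Morphism → List Word → Set
Avoids g fs = All (λ f → ¬ Factor (g ⟨ f ⟩)) fs

forbidden? : ∀ fs u → Dec (Any (λ f → Prefix.Prefix _≡_ f u) fs)
forbidden? fs u = any? (λ f → prefix? _≟_ f u) fs

-- The tree grows to the left, so that a new forbidden factor is always a prefix.
search : (Word → Bool) → List Word → ℕ → Word → Bool
search ok fs zero    u = isYes (forbidden? fs u)
search ok fs (suc k) u =
  isYes (forbidden? fs u) ∨ ok u ∧ search ok fs k (𝟎 ∷ u) ∧ search ok fs k (𝟏 ∷ u)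

module _ {g : Morphism} {fs : List Word} (avoids : Avoids g fs) where

  -- A branch cut at `u` may be cut for good: every word below it ends in `u`, so its image contains
  -- the image of the forbidden prefix of `u`.
  avoids-prefix : ∀ u → True (forbidden? fs u) → ∀ v → ¬ Factor (g ⟨ v ʳ++ u ⟩)
  avoids-prefix u t v o = go avoids (toWitness t)
    where
    suffix : Factor (g ⟨ u ⟩)
    suffix = Factor-++ʳ (g ⟨ reverse v ⟩)
      (subst Factor (trans (cong (g ⟨_⟩) (ʳ++-defn v)) (concatMap-++ g (reverse v) u)) o)
    prefix-image : ∀ {f w} → Prefix.PrefixView _≡_ f w → Factor (g ⟨ w ⟩) → Factor (g ⟨ f ⟩)
    prefix-image {f} (eqs Prefix.++ v) o with refl ← Pointwise-≡⇒≡ eqs =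
      Factor-++ˡ (g ⟨ f ⟩) (subst Factor (concatMap-++ g f v) o)
    go : ∀ {fs} → Avoids g fs → ¬ Any (λ f → Prefix.Prefix _≡_ f u) fs
    go (¬f ∷ _)  (here p)  = ¬f (prefix-image (Prefix.toView p) suffix)
    go (_ ∷ ¬fs) (there i) = go ¬fs i

  -- The letters of `v` are the path from the node `u` to the word in question, the nearest letter
  -- first.
  search-sound : ∀ {ok} k u → T (search ok fs k u) →
                 ∀ v → Factor (g ⟨ v ʳ++ u ⟩) → T (ok (v ʳ++ u))
  search-sound zero    u t v o = contradiction o (avoids-prefix u t v)
  search-sound {ok} (suc k) u t v o with Equivalence.to T-∨ t
  ... | inj₁ t = contradiction o (avoids-prefix u t v)
  ... | inj₂ t = go v o
    where
    node : T (ok u) × T (search ok fs k (𝟎 ∷ u) ∧ search ok fs k (𝟏 ∷ u))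
    node = Equivalence.to T-∧ t
    children : T (search ok fs k (𝟎 ∷ u)) × T (search ok fs k (𝟏 ∷ u))
    children = Equivalence.to T-∧ (proj₂ node)
    go : ∀ v → Factor (g ⟨ v ʳ++ u ⟩) → T (ok (v ʳ++ u))
    go []      _ = proj₁ node
    go (𝟎 ∷ v) o = search-sound k (𝟎 ∷ u) (proj₁ children) v o
    go (𝟏 ∷ v) o = search-sound k (𝟏 ∷ u) (proj₂ children) v o

  search-complete : ∀ ok k → T (search ok fs k []) → ∀ p → Factor (g ⟨ p ⟩) → T (ok p)
  search-complete ok k t p o =
    subst (T ∘ ok) (reverse-involutive p)
      (search-sound k [] t (reverse p) (subst (λ q → Factor (g ⟨ q ⟩)) (sym (reverse-involutive p)) o))

-- Certifying the two possibilities by computation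

Outcome : Word → Set
Outcome p = Possibility₁ p ⊎ Possibility₂ p

complement-involutive : ∀ p → complement (complement p) ≡ p
complement-involutive p = trans (sym (map-∘ p)) (trans (map-cong not-involutive p) (map-id p))

swap-complement : ∀ {P : Word → Set} p → Any P (p ∷ complement p ∷ []) →
                  Any P (complement p ∷ complement (complement p) ∷ [])
swap-complement {P} p (here Pp)          = there (here (subst P (sym (complement-involutive p)) Pp))
swap-complement     p (there (here Pp̄)) = here Pp̄

Outcome-complement : ∀ p → Outcome (complement p) → Outcome p
Outcome-complement p =
  subst Outcome (complement-involutive p) ∘ map-⊎ (swap-complement (complement p)) (swap-complement (complement p))

IsPrefix-drop : ∀ u {v} w → IsPrefix (u ++ v) w → IsPrefix v (λ j → w (length u + j))
IsPrefix-drop []      w eq = eq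
IsPrefix-drop (a ∷ u) w eq = IsPrefix-drop u (w ∘ suc) (proj₂ (∷-injective eq))

infix⇒IsFactor : ∀ n → Infix _≡_ u (δ^ n [0]) → IsFactor u 𝐝
infix⇒IsFactor {u} n i = go (toView i) refl
  where
  go : ∀ {w} → View _≡_ u w → w ≡ δ^ n [0] → IsFactor u 𝐝
  go (MkView l eqs r) eq with refl ← Pointwise-≡⇒≡ eqs =
    length l , prefix-++ _ u r (IsPrefix-drop l 𝐝 (subst (λ w → IsPrefix w 𝐝) (sym eq) (δ^-prefix n)))

-- The first 64 letters of 𝐝 contain all the factors that are ever looked up.
FactorCondition₆ Evident : Word → Set
FactorCondition₆ q = Any (λ g → Infix _≡_ (g ⟨ q ⟩) (δ^ 6 [0])) ([_] ∷ h₁ ∷ h₂ ∷ [])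
Evident p = Any (λ q → FactorCondition₆ q ⊎ q ∈ exceptionalWords) (p ∷ complement p ∷ [])

evident? : ∀ p → Dec (Evident p)
evident? p = any? (λ q → any? (λ g → infix? _≟_ (g ⟨ q ⟩) (δ^ 6 [0])) _
                           ⊎-dec any? (≡-dec _≟_ q) exceptionalWords) _

FactorCondition₆⇒FactorCondition : ∀ q → FactorCondition₆ q → FactorCondition q
FactorCondition₆⇒FactorCondition q (here i) =
  inj₁ (subst (λ u → IsFactor u 𝐝) (concatMap-pure q) (infix⇒IsFactor 6 i))
FactorCondition₆⇒FactorCondition q (there (here i))         = inj₂ (inj₁ (infix⇒IsFactor 6 i))
FactorCondition₆⇒FactorCondition q (there (there (here i))) = inj₂ (inj₂ (infix⇒IsFactor 6 i))

Evident⇒Outcome : ∀ {p} → Evident p → Outcome p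
Evident⇒Outcome (here (inj₁ c))         = inj₁ (here (FactorCondition₆⇒FactorCondition _ c))
Evident⇒Outcome (here (inj₂ e))         = inj₂ (here e)
Evident⇒Outcome (there (here (inj₁ c))) = inj₁ (there (here (FactorCondition₆⇒FactorCondition _ c)))
Evident⇒Outcome (there (here (inj₂ e))) = inj₂ (there (here e))

-- The list `f q` holds the patterns for which the searched word `q` may stand; with `[_]` the
-- searched word is the pattern itself.
certified : (Word → List Word) → Word → Bool
certified f q = isYes (All.all? evident? (f q))

certified⇒Outcome : ∀ f q → T (certified f q) → All Outcome (f q)
certified⇒Outcome f q t = All.map Evident⇒Outcome (toWitness {a? = All.all? evident? (f q)} t)

-- Morphisms with an image of odd length

fourth-powers : ∀ (g : Morphism) → NonErasing g → ∀ a u → let x = a ∷ u in ¬ Factor (g ⟨ x ++ x ++ x ++ x ⟩)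
fourth-powers g ≢[] a u o = ¬fourth-power (g ⟨ x ⟩) (nonEmpty (g a) (≢[] a)) (subst Factor images o)
  where
  x = a ∷ u
  nonEmpty : ∀ v → v ≢ [] → v ++ g ⟨ u ⟩ ≢ []
  nonEmpty []      ≢[] _ = ≢[] refl
  nonEmpty (_ ∷ _) ≢[] ()
  images : g ⟨ x ++ x ++ x ++ x ⟩ ≡ g ⟨ x ⟩ ++ g ⟨ x ⟩ ++ g ⟨ x ⟩ ++ g ⟨ x ⟩
  images = trans (concatMap-++ g x _) (cong (g ⟨ x ⟩ ++_)
          (trans (concatMap-++ g x _) (cong (g ⟨ x ⟩ ++_) (concatMap-++ g x x))))

¬odd-return-image : ∀ (g : Morphism) a v → OneParity (g a) → ∥ g ⟨ a ∷ v ⟩ ∥ ≡ 1ℙ →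
                    ¬ Factor (g ⟨ a ∷ v ++ [ a ] ⟩)
¬odd-return-image g a v one odd o = ¬odd-return one (g ⟨ v ⟩) odd
  (subst Factor (cong (g a ++_) (trans (concatMap-++ g v [ a ]) (cong (g ⟨ v ⟩ ++_) (++-identityʳ (g a))))) o)

-- If both images are odd, 00 and 11 give odd squares, and the remaining alternating words reach a
-- fourth power at length 8. If only the image of 0 is odd, two 0s separated by at most three 1s
-- give an odd return and 1111 is a fourth power, so p has at most one 0 and seven letters.
oddFactors mixedFactors : List Word
oddFactors
  = (𝟎 ∷ 𝟎 ∷ [])
  ∷ (𝟏 ∷ 𝟏 ∷ [])
  ∷ (𝟎 ∷ 𝟏 ∷ 𝟎 ∷ 𝟏 ∷ 𝟎 ∷ 𝟏 ∷ 𝟎 ∷ 𝟏 ∷ [])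
  ∷ (𝟏 ∷ 𝟎 ∷ 𝟏 ∷ 𝟎 ∷ 𝟏 ∷ 𝟎 ∷ 𝟏 ∷ 𝟎 ∷ [])
  ∷ []
mixedFactors
  = (𝟎 ∷ 𝟎 ∷ [])
  ∷ (𝟎 ∷ 𝟏 ∷ 𝟎 ∷ [])
  ∷ (𝟎 ∷ 𝟏 ∷ 𝟏 ∷ 𝟎 ∷ [])
  ∷ (𝟎 ∷ 𝟏 ∷ 𝟏 ∷ 𝟏 ∷ 𝟎 ∷ [])
  ∷ (𝟏 ∷ 𝟏 ∷ 𝟏 ∷ 𝟏 ∷ [])
  ∷ []

-- A record rather than a product, so that the searches are run only where a
-- certificate is built and not whenever two such types are compared.
record Certificate (ok : Word → Bool) : Set where
  constructor certificate
  field
    odd   : T (search ok oddFactors 8 [])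
    mixed : T (search ok mixedFactors 8 [])

odd-search : ∀ {ok} → Certificate ok → ∀ (g : Morphism) → NonErasing g →
             ∥ g 𝟎 ∥ ≡ 1ℙ → g 𝟎 ≢ [ 𝟎 ] → g 𝟏 ≢ [ 𝟎 ] →
             ∀ p → Factor (g ⟨ p ⟩) → T (ok p)
odd-search {ok} (certificate odd mixed) g ≢[] odd₀ g0≢0 g1≢0 with ∥ g 𝟏 ∥ in ∥g1∥
... | 1ℙ = search-complete avoids ok 8 odd
  where
  avoids : Avoids g oddFactors
  avoids = ¬odd-return-image g 𝟎 [] (oneParity-odd (g 𝟎) odd₀ g0≢0) (∥⟨⟩∥ g odd₀ ∥g1∥ [ 𝟎 ])
         ∷ ¬odd-return-image g 𝟏 [] (oneParity-odd (g 𝟏) ∥g1∥ g1≢0) (∥⟨⟩∥ g odd₀ ∥g1∥ [ 𝟏 ])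
         ∷ fourth-powers g ≢[] 𝟎 [ 𝟏 ]
         ∷ fourth-powers g ≢[] 𝟏 [ 𝟎 ]
         ∷ []
... | 0ℙ = search-complete avoids ok 8 mixed
  where
  return : ∀ v → imageParity 1ℙ 0ℙ (𝟎 ∷ v) ≡ 1ℙ → ¬ Factor (g ⟨ 𝟎 ∷ v ++ [ 𝟎 ] ⟩)
  return v odd = ¬odd-return-image g 𝟎 v (oneParity-odd (g 𝟎) odd₀ g0≢0)
    (trans (∥⟨⟩∥ g odd₀ ∥g1∥ (𝟎 ∷ v)) odd)
  avoids : Avoids g mixedFactors
  avoids = return [] refl
         ∷ return [ 𝟏 ] refl
         ∷ return (𝟏 ∷ 𝟏 ∷ []) refl
         ∷ return (𝟏 ∷ 𝟏 ∷ 𝟏 ∷ []) refl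
         ∷ fourth-powers g ≢[] 𝟏 []
         ∷ []

-- Morphisms fixing 0

⟪_,_⟫ : Word → Word → Morphism
⟪ A , B ⟫ 𝟎 = A
⟪ A , B ⟫ 𝟏 = B

words : ℕ → List Word
words zero    = [] ∷ []
words (suc n) = map (𝟎 ∷_) (words n) ++ map (𝟏 ∷_) (words n)

-- Meant for `B` among 0, 00 and 11: the image of any four letters then contains 0000 or 11, so only
-- patterns of at most three letters remain.
short-image : ∀ B → True (All.all? (λ f → T? (absent 3 (⟪ [ 𝟎 ] , B ⟫ ⟨ f ⟩))) (words 4)) →
              ∀ p → Factor (⟪ [ 𝟎 ] , B ⟫ ⟨ p ⟩) → Outcome p
short-image B t p o = All.head (certified⇒Outcome [_] p (search-complete avoids (certified [_]) 4 _ p o))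
  where
  avoids : Avoids ⟪ [ 𝟎 ] , B ⟫ (words 4)
  avoids = All.map (absent⇒¬Factor 3 _) (toWitness t)

-- The block 00 desubstitutes to 1, an image of odd length other than 0, so `odd-search` applies to
-- the coded word.
coded : ∀ f → Certificate (certified f) → ∀ u → u ≢ [] → u ≢ [ 𝟎 ] →
        ∀ q → Factor (⟪ [ 𝟏 ] , u ⟫ ⟨ q ⟩) → All Outcome (f q)
coded f cert u ≢[] ≢0 q o = certified⇒Outcome f q
  (odd-search cert ⟪ [ 𝟏 ] , u ⟫ (λ { 𝟎 () ; 𝟏 → ≢[] }) refl (λ ()) ≢0 q o)

Occurs-∷∷ : ∀ {a b} → Occurs π (a ∷ b ∷ u) → Occurs π u
Occurs-∷∷ {0ℙ} o = Occurs-tail (Occurs-tail o)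
Occurs-∷∷ {1ℙ} o = Occurs-tail (Occurs-tail o)

-- When g(1) occurs at one parity only, p is read along the blocks of two letters
-- in which g(p) is desubstituted: 00 is one block, and c is g(1) completed to
-- whole blocks.  A last 0 may be half a block.
Parse : Word → Word → Set
Parse c p = ∃[ q ] (p ≡ ⟪ 𝟎 ∷ 𝟎 ∷ [] , c ⟫ ⟨ q ⟩ ⊎ p ≡ ⟪ 𝟎 ∷ 𝟎 ∷ [] , c ⟫ ⟨ q ⟩ ++ [ 𝟎 ])

parse-∷ : ∀ {c p} a → Parse c p → Parse c (⟪ 𝟎 ∷ 𝟎 ∷ [] , c ⟫ a ++ p)
parse-∷ {c} a (q , inj₁ refl) = a ∷ q , inj₁ refl
parse-∷ {c} a (q , inj₂ refl) = a ∷ q , inj₂ (sym (++-assoc (⟪ 𝟎 ∷ 𝟎 ∷ [] , c ⟫ a) _ _))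

-- Blocks of even length keep the reading at parity `π`; a single 0 before a 1 would put `B` at the
-- excluded parity.
parse-even : ∀ B → ∥ B ∥ ≡ 0ℙ → ¬ Occurs (π ⁻¹) B →
             ∀ p → Occurs π (⟪ [ 𝟎 ] , B ⟫ ⟨ p ⟩) → Parse [ 𝟏 ] p
parse-even B even ¬B []          o = [] , inj₁ refl
parse-even B even ¬B (𝟎 ∷ [])    o = [] , inj₂ refl
parse-even B even ¬B (𝟎 ∷ 𝟎 ∷ p) o = parse-∷ 𝟎 (parse-even B even ¬B p (Occurs-∷∷ o))
parse-even B even ¬B (𝟎 ∷ 𝟏 ∷ p) o = contradiction (Occurs-++ˡ B (Occurs-tail o)) ¬B
parse-even {π} B even ¬B (𝟏 ∷ p) o =
  parse-∷ 𝟏 (parse-even B even ¬B p (subst (λ ρ → Occurs (ρ ⊕ π) (⟪ [ 𝟎 ] , B ⟫ ⟨ p ⟩)) even (Occurs-++ʳ B o)))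

-- Read from an even position, `B` can only follow a single 0, and that 0 completes it to even
-- length.
parse-odd : ∀ B → ∥ B ∥ ≡ 1ℙ → ¬ Occurs 0ℙ B →
            ∀ p → Occurs 0ℙ (⟪ [ 𝟎 ] , B ⟫ ⟨ p ⟩) → Parse (𝟎 ∷ 𝟏 ∷ []) p
parse-odd B odd ¬B []          o = [] , inj₁ refl
parse-odd B odd ¬B (𝟎 ∷ [])    o = [] , inj₂ refl
parse-odd B odd ¬B (𝟎 ∷ 𝟎 ∷ p) o = parse-∷ 𝟎 (parse-odd B odd ¬B p (Occurs-∷∷ o))
parse-odd B odd ¬B (𝟎 ∷ 𝟏 ∷ p) o = parse-∷ 𝟏 (parse-odd B odd ¬B p
  (subst (λ ρ → Occurs (ρ ⊕ 1ℙ) (⟪ [ 𝟎 ] , B ⟫ ⟨ p ⟩)) odd (Occurs-++ʳ B (Occurs-tail o))))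
parse-odd B odd ¬B (𝟏 ∷ p)     o = contradiction (Occurs-++ˡ B o) ¬B

module _ (π : Parity) (B c : Word) where

  private
    g = ⟪ [ 𝟎 ] , B ⟫
    e = ⟪ 𝟎 ∷ 𝟎 ∷ [] , c ⟫
    K = g ⟨ c ⟩
    gₑ = ⟪ 𝟎 ∷ 𝟎 ∷ [] , K ⟫

  expand : ∀ q → g ⟨ e ⟨ q ⟩ ⟩ ≡ gₑ ⟨ q ⟩
  expand []      = refl
  expand (𝟎 ∷ q) = cong (λ u → 𝟎 ∷ 𝟎 ∷ u) (expand q)
  expand (𝟏 ∷ q) = trans (concatMap-++ g c (e ⟨ q ⟩)) (cong (K ++_) (expand q))

  module _ (even : ∥ K ∥ ≡ 0ℙ) where

    -- Both images under `gₑ` have even length, so `half` acts on them separately, and it sends 00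
    -- to 1 at either parity.
    half-parsed : ∀ q v → half π (g ⟨ e ⟨ q ⟩ ⟩ ++ v) ≡ ⟪ [ 𝟏 ] , half π K ⟫ ⟨ q ⟩ ++ half π v
    half-parsed q v = trans (half-++ π (g ⟨ e ⟨ q ⟩ ⟩) v even′) (cong (_++ half π v)
      (trans (cong (half π) (expand q))
      (trans (half-⟨⟩ π gₑ (λ { 𝟎 → refl ; 𝟏 → even }) q) (concatMap-cong (letters π) q))))
      where
      letters : ∀ π → half π ∘ gₑ ≗ ⟪ [ 𝟏 ] , half π K ⟫
      letters 0ℙ 𝟎 = refl
      letters 1ℙ 𝟎 = refl
      letters π  𝟏 = refl
      zeros : ∀ q → imageParity 0ℙ 0ℙ q ≡ 0ℙ
      zeros []      = refl
      zeros (𝟎 ∷ q) = zeros q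
      zeros (𝟏 ∷ q) = zeros q
      even′ : ∥ g ⟨ e ⟨ q ⟩ ⟩ ∥ ≡ 0ℙ
      even′ = trans (cong ∥_∥ (expand q)) (trans (∥⟨⟩∥ gₑ refl even q) (zeros q))

    Factor-parsed : ∀ q v → Occurs π (g ⟨ e ⟨ q ⟩ ++ v ⟩) → Factor (⟪ [ 𝟏 ] , half π K ⟫ ⟨ q ⟩ ++ half π (g ⟨ v ⟩))
    Factor-parsed q v o = subst Factor (half-parsed q (g ⟨ v ⟩))
      (Occurs-half _ (subst (Occurs π) (concatMap-++ g (e ⟨ q ⟩) v) o))

    Factor-parsed-[] : ∀ q → Occurs π (g ⟨ e ⟨ q ⟩ ⟩) → Factor (⟪ [ 𝟏 ] , half π K ⟫ ⟨ q ⟩)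
    Factor-parsed-[] q o = Factor-++ˡ (⟪ [ 𝟏 ] , half π K ⟫ ⟨ q ⟩)
      (Factor-parsed q [] (subst (λ u → Occurs π (g ⟨ u ⟩)) (sym (++-identityʳ (e ⟨ q ⟩))) o))

-- An occurrence of g(p) at an odd position extends to one of g(0p), which is
-- why the candidates include words without their first letter.
evenCandidates : Word → Word → List Word
evenCandidates c q = x ∷ (x ++ [ 𝟎 ]) ∷ drop 1 x ∷ drop 1 (x ++ [ 𝟎 ]) ∷ []
  where x = ⟪ 𝟎 ∷ 𝟎 ∷ [] , c ⟫ ⟨ q ⟩

parsed-from-even : ∀ c → Certificate (certified (evenCandidates c)) →
  ∀ B → let K = ⟪ [ 𝟎 ] , B ⟫ ⟨ c ⟩ in ∥ K ∥ ≡ 0ℙ → half 0ℙ K ≢ [] → half 0ℙ K ≢ [ 𝟎 ] →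
  (∀ p → Occurs 0ℙ (⟪ [ 𝟎 ] , B ⟫ ⟨ p ⟩) → Parse c p) →
  ∀ p → Factor (⟪ [ 𝟎 ] , B ⟫ ⟨ p ⟩) → Outcome p
parsed-from-even c cert B even ≢[] ≢0 parse p (π , o) = align π o
  where
  x = half 0ℙ (⟪ [ 𝟎 ] , B ⟫ ⟨ c ⟩)
  outcomes : ∀ p → Parse c p → Occurs 0ℙ (⟪ [ 𝟎 ] , B ⟫ ⟨ p ⟩) → Outcome p × Outcome (drop 1 p)
  outcomes p (q , inj₁ refl) o = All.head all , All.head (All.tail (All.tail all))
    where all = coded (evenCandidates c) cert x ≢[] ≢0 q (Factor-parsed-[] 0ℙ B c even q o)
  -- At even parity the unpaired last 0 has no preimage; the candidates ending in an extra 0 restore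
  -- it.
  outcomes p (q , inj₂ refl) o = All.head (All.tail all) , All.head (All.tail (All.tail (All.tail all)))
    where all = coded (evenCandidates c) cert x ≢[] ≢0 q
                  (Factor-++ˡ (⟪ [ 𝟏 ] , x ⟫ ⟨ q ⟩) (Factor-parsed 0ℙ B c even q [ 𝟎 ] o))
  align : ∀ π → Occurs π (⟪ [ 𝟎 ] , B ⟫ ⟨ p ⟩) → Outcome p
  align 0ℙ o = proj₁ (outcomes p (parse p o) o)
  align 1ℙ o = proj₂ (outcomes (𝟎 ∷ p) (parse (𝟎 ∷ p) (Occurs-0∷ o)) (Occurs-0∷ o))

dropLast : Word → Word
dropLast []          = []
dropLast (a ∷ [])    = []
dropLast (a ∷ b ∷ u) = a ∷ dropLast (b ∷ u)

dropLast-++ : ∀ u a b → dropLast (u ++ a ∷ b ∷ []) ≡ u ++ [ a ]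
dropLast-++ []          a b = refl
dropLast-++ (_ ∷ [])    a b = refl
dropLast-++ (_ ∷ c ∷ u) a b = cong (_ ∷_) (dropLast-++ (c ∷ u) a b)

-- A last half block 0 at an odd position still determines its preimage 1 = g′(0),
-- so it is read as 00 without its last letter.
oddCandidates : Word → List Word
oddCandidates q = x ∷ (𝟎 ∷ x) ∷ dropLast x ∷ dropLast (𝟎 ∷ x) ∷ []
  where x = ⟪ 𝟎 ∷ 𝟎 ∷ [] , [ 𝟏 ] ⟫ ⟨ q ⟩

oddCertificate : Certificate (certified oddCandidates)
oddCertificate = certificate tt tt

-- At odd parity the pattern parses directly. At even parity it cannot begin with 1; a first 0 is
-- removed to reach odd parity and put back by the candidates that begin with an extra 0.
even-image-at-odd : ∀ B → ∥ B ∥ ≡ 0ℙ → ¬ Occurs 0ℙ B →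
  let K = B ++ [] in ∥ K ∥ ≡ 0ℙ → half 1ℙ K ≢ [] → half 1ℙ K ≢ [ 𝟎 ] →
  ∀ p → Factor (⟪ [ 𝟎 ] , B ⟫ ⟨ p ⟩) → Outcome p
even-image-at-odd B even ¬B evenK ≢[] ≢0 = align
  where
  g = ⟪ [ 𝟎 ] , B ⟫
  e = ⟪ 𝟎 ∷ 𝟎 ∷ [] , [ 𝟏 ] ⟫
  x = half 1ℙ (B ++ [])
  outcomes : ∀ p → Parse [ 𝟏 ] p → Occurs 1ℙ (g ⟨ p ⟩) → Outcome p × Outcome (𝟎 ∷ p)
  outcomes p (q , inj₁ refl) o = All.head all , All.head (All.tail all)
    where all = coded oddCandidates oddCertificate x ≢[] ≢0 q (Factor-parsed-[] 1ℙ B [ 𝟏 ] evenK q o)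
  outcomes p (q , inj₂ refl) o =
    subst Outcome (trans (cong dropLast (concatMap-++ e q [ 𝟎 ])) (dropLast-++ (e ⟨ q ⟩) 𝟎 𝟎))
      (All.head (All.tail (All.tail all))) ,
    subst Outcome (trans (cong (dropLast ∘ (𝟎 ∷_)) (concatMap-++ e q [ 𝟎 ])) (dropLast-++ (𝟎 ∷ e ⟨ q ⟩) 𝟎 𝟎))
      (All.head (All.tail (All.tail (All.tail all))))
    where all = coded oddCandidates oddCertificate x ≢[] ≢0 (q ++ [ 𝟎 ])
                  (subst Factor (sym (concatMap-++ ⟪ [ 𝟏 ] , x ⟫ q [ 𝟎 ])) (Factor-parsed 1ℙ B [ 𝟏 ] evenK q [ 𝟎 ] o))
  align : ∀ p → Factor (g ⟨ p ⟩) → Outcome p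
  align p       (1ℙ , o) = proj₁ (outcomes p (parse-even B even ¬B p o) o)
  align []      (0ℙ , o) = Evident⇒Outcome (toWitness {a? = evident? []} _)
  align (𝟎 ∷ p) (0ℙ , o) = proj₂ (outcomes p (parse-even B even ¬B p (Occurs-tail o)) (Occurs-tail o))
  align (𝟏 ∷ p) (0ℙ , o) = contradiction (Occurs-++ˡ B o) ¬B

-- For `B` of odd length occurring only at even positions: 11 and 1001 are odd returns, and 1000
-- yields 0000 because `B` ends in a 0. In 0001 the zeros would start at an odd position. What is
-- left has isolated 1s separated by single 0s, at most nine letters in all.
isolatedFactors : List Word
isolatedFactors
  = (𝟏 ∷ 𝟏 ∷ [])
  ∷ (𝟏 ∷ 𝟎 ∷ 𝟎 ∷ 𝟏 ∷ [])
  ∷ (𝟏 ∷ 𝟎 ∷ 𝟎 ∷ 𝟎 ∷ [])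
  ∷ (𝟎 ∷ 𝟎 ∷ 𝟎 ∷ 𝟏 ∷ [])
  ∷ (𝟎 ∷ 𝟎 ∷ 𝟎 ∷ 𝟎 ∷ [])
  ∷ (𝟎 ∷ 𝟏 ∷ 𝟎 ∷ 𝟏 ∷ 𝟎 ∷ 𝟏 ∷ 𝟎 ∷ 𝟏 ∷ [])
  ∷ (𝟏 ∷ 𝟎 ∷ 𝟏 ∷ 𝟎 ∷ 𝟏 ∷ 𝟎 ∷ 𝟏 ∷ 𝟎 ∷ [])
  ∷ []

-- The last letter of `u` stands at an even position, hence is 0.
even-last : ∀ u → ∥ u ∥ ≡ 1ℙ → Occurs 0ℙ (u ++ v) → Factor (𝟎 ∷ v)
even-last (𝟎 ∷ [])    odd o = 0ℙ , o
even-last (𝟏 ∷ [])    odd o = contradiction o ¬Occurs-even-1∷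
even-last (_ ∷ _ ∷ u) odd o = even-last u odd (Occurs-∷∷ o)

odd-image-at-even : ∀ B → B ≢ [] → ∥ B ∥ ≡ 1ℙ → ¬ Occurs 1ℙ B →
  ∀ p → Factor (⟪ [ 𝟎 ] , B ⟫ ⟨ p ⟩) → Outcome p
odd-image-at-even B ≢[] odd ¬B p o =
  All.head (certified⇒Outcome [_] p (search-complete avoids (certified [_]) 12 _ p o))
  where
  g = ⟪ [ 𝟎 ] , B ⟫
  nonErasing : NonErasing g
  nonErasing 𝟎 ()
  nonErasing 𝟏 = ≢[]
  return : ∀ v → imageParity 1ℙ 1ℙ (𝟏 ∷ v) ≡ 1ℙ → ¬ Factor (g ⟨ 𝟏 ∷ v ++ [ 𝟏 ] ⟩)
  return v eq = ¬odd-return-image g 𝟏 v (inj₂ ¬B) (trans (∥⟨⟩∥ g refl odd (𝟏 ∷ v)) eq)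
  ¬1000 : ¬ Factor (B ++ 𝟎 ∷ 𝟎 ∷ 𝟎 ∷ [])
  ¬1000 (0ℙ , o) = ¬Factor-0000 (even-last B odd o)
  ¬1000 (1ℙ , o) = ¬B (Occurs-++ˡ B o)
  ¬0001 : ¬ Factor (𝟎 ∷ 𝟎 ∷ 𝟎 ∷ B ++ [])
  ¬0001 (0ℙ , o) = ¬B (Occurs-++ˡ B (Occurs-tail (Occurs-∷∷ o)))
  ¬0001 (1ℙ , o) = ¬Occurs-odd-000 o
  avoids : Avoids g isolatedFactors
  avoids = return [] refl
         ∷ return (𝟎 ∷ 𝟎 ∷ []) refl
         ∷ ¬1000
         ∷ ¬0001
         ∷ ¬Factor-0000
         ∷ fourth-powers g nonErasing 𝟎 [ 𝟏 ]
         ∷ fourth-powers g nonErasing 𝟏 [ 𝟎 ]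
         ∷ []

-- Three letters suffice for `oneParity`; the four cases combine the parity of the length of g(1)
-- with the parity of its positions.
long-image : ∀ a b c u p → Factor (⟪ [ 𝟎 ] , a ∷ b ∷ c ∷ u ⟫ ⟨ p ⟩) → Outcome p
long-image a b c u = cases u _ refl (oneParity (a ∷ b ∷ c ∷ u) (λ ()) (λ ()) (λ ()))
  where
  cases : ∀ u σ → ∥ c ∷ u ∥ ≡ σ → OneParity (a ∷ b ∷ c ∷ u) →
          ∀ p → Factor (⟪ [ 𝟎 ] , a ∷ b ∷ c ∷ u ⟫ ⟨ p ⟩) → Outcome p
  -- Even length forces a fourth letter `d`, so the desubstituted image has at least two letters and
  -- is neither empty nor 0.
  cases (d ∷ u) 0ℙ even (inj₂ ¬1) = parsed-from-even [ 𝟏 ] (certificate tt tt) (a ∷ b ∷ c ∷ d ∷ u)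
    (trans (cong ∥_∥ (++-identityʳ u)) even) (λ ()) (λ ()) (parse-even (a ∷ b ∷ c ∷ d ∷ u) even ¬1)
  cases (d ∷ u) 0ℙ even (inj₁ ¬0) = even-image-at-odd (a ∷ b ∷ c ∷ d ∷ u) even ¬0
    (trans (cong ∥_∥ (++-identityʳ u)) even) (λ ()) (λ ())
  cases u 1ℙ odd (inj₂ ¬1) = odd-image-at-even (a ∷ b ∷ c ∷ u) (λ ()) odd ¬1
  cases u 1ℙ odd (inj₁ ¬0) = parsed-from-even (𝟎 ∷ 𝟏 ∷ []) (certificate tt tt) (a ∷ b ∷ c ∷ u)
    (trans (cong (λ v → ∥ 𝟎 ∷ c ∷ v ∥) (++-identityʳ u)) (trans (∥++∥ [ 𝟎 ] (c ∷ u)) (cong (1ℙ ⊕_) odd)))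
    (λ ()) (λ ()) (parse-odd (a ∷ b ∷ c ∷ u) odd ¬0)

image-of-0-is-0 : ∀ B → B ≢ [] → ∀ p → Factor (⟪ [ 𝟎 ] , B ⟫ ⟨ p ⟩) → Outcome p
image-of-0-is-0 []               ≢[] p o = contradiction refl ≢[]
image-of-0-is-0 (𝟎 ∷ [])         _   p o = short-image _ tt p o
image-of-0-is-0 (𝟎 ∷ 𝟎 ∷ [])     _   p o = short-image _ tt p o
image-of-0-is-0 (𝟏 ∷ 𝟏 ∷ [])     _   p o = short-image _ tt p o
image-of-0-is-0 (𝟏 ∷ [])         _   p o = inj₁ (here (inj₁ (Factor⇒IsFactor p
  (subst Factor (trans (concatMap-cong (λ { 𝟎 → refl ; 𝟏 → refl }) p) (concatMap-pure p)) o))))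
image-of-0-is-0 (𝟎 ∷ 𝟏 ∷ [])     _   p o = inj₁ (here (inj₂ (inj₁ (Factor⇒IsFactor (h₁ ⟨ p ⟩)
  (subst Factor (concatMap-cong (λ { 𝟎 → refl ; 𝟏 → refl }) p) o)))))
image-of-0-is-0 (𝟏 ∷ 𝟎 ∷ [])     _   p o = inj₁ (here (inj₂ (inj₂ (Factor⇒IsFactor (h₂ ⟨ p ⟩)
  (subst Factor (concatMap-cong (λ { 𝟎 → refl ; 𝟏 → refl }) p) o)))))
image-of-0-is-0 (a ∷ b ∷ c ∷ u)  _   p o = long-image a b c u p o

-- Reduction to an image of odd length

odd-image : ∀ (g : Morphism) → NonErasing g → ∥ g 𝟎 ∥ ≡ 1ℙ → ∀ p → Factor (g ⟨ p ⟩) → Outcome p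
odd-image g ≢[] odd p o with ≡-dec _≟_ (g 𝟎) [ 𝟎 ] | ≡-dec _≟_ (g 𝟏) [ 𝟎 ]
... | yes g0≡0 | _ = image-of-0-is-0 (g 𝟏) (≢[] 𝟏) p
  (subst Factor (concatMap-cong (λ { 𝟎 → g0≡0 ; 𝟏 → refl }) p) o)
... | no _ | yes g1≡0 = Outcome-complement p (image-of-0-is-0 (g 𝟎) (≢[] 𝟎) (complement p)
  (subst Factor (trans (concatMap-cong (λ { 𝟎 → refl ; 𝟏 → g1≡0 }) p) (sym (concatMap-map ⟪ [ 𝟎 ] , g 𝟎 ⟫ not p))) o))
... | no g0≢0 | no g1≢0 = All.head (certified⇒Outcome [_] p
  (odd-search {certified [_]} (certificate tt tt) g ≢[] odd g0≢0 g1≢0 p o))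

-- Induction on a bound for the length of g(0), which strictly decreases when both images are even
-- and can be desubstituted.
image⇒Outcome : ∀ k (g : Morphism) → length (g 𝟎) ≤ k → NonErasing g → ∀ p → Factor (g ⟨ p ⟩) → Outcome p
image⇒Outcome zero    g ≤0 ≢[] p o with [] ← g 𝟎 in eq = contradiction eq (≢[] 𝟎)
image⇒Outcome (suc k) g ≤k ≢[] p o = by-parity _ _ refl refl
  where
  by-parity : ∀ σ τ → ∥ g 𝟎 ∥ ≡ σ → ∥ g 𝟏 ∥ ≡ τ → Outcome p
  by-parity 1ℙ _  odd  _   = odd-image g ≢[] odd p o
  by-parity 0ℙ 1ℙ _    odd = Outcome-complement p
    (odd-image (g ∘ not) (≢[] ∘ not) odd (complement p) (subst Factor (trans
      (concatMap-cong (λ { 𝟎 → refl ; 𝟏 → refl }) p) (sym (concatMap-map (g ∘ not) not p))) o))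
  by-parity 0ℙ 0ℙ even₀ even₁ =
    image⇒Outcome k (half ρ ∘ g) (s≤s⁻¹ (≤-trans (length-half-< ρ (g 𝟎) even₀ (≢[] 𝟎)) ≤k))
      (λ a → half-≢[] ρ (g a) (even a) (≢[] a)) p
      (subst Factor (half-⟨⟩ ρ g even p) (Occurs-half (g ⟨ p ⟩) (proj₂ o)))
    where
    ρ = proj₁ o
    even : ∀ a → ∥ g a ∥ ≡ 0ℙ
    even 𝟎 = even₀
    even 𝟏 = even₁

Encounters⇒Outcome : ∀ p → Encounters 𝐝 p → Outcome p
Encounters⇒Outcome p (g , ≢[] , i) = image⇒Outcome _ g ≤-refl ≢[] p (IsFactor⇒Factor (g ⟨ p ⟩) i)

-- Encounters obtained from the two possibilities

Encounters-complement : ∀ p → Encounters 𝐝 (complement p) → Encounters 𝐝 p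
Encounters-complement p (g , ≢[] , i) =
  g ∘ not , ≢[] ∘ not , subst (λ u → IsFactor u 𝐝) (concatMap-map g not p) i

FactorCondition⇒Encounters : ∀ q → FactorCondition q → Encounters 𝐝 q
FactorCondition⇒Encounters q (inj₁ i) =
  [_] , (λ a ()) , subst (λ u → IsFactor u 𝐝) (sym (concatMap-pure q)) i
FactorCondition⇒Encounters q (inj₂ (inj₁ i)) = h₁ , (λ { 𝟎 () ; 𝟏 () }) , i
FactorCondition⇒Encounters q (inj₂ (inj₂ i)) = h₂ , (λ { 𝟎 () ; 𝟏 () }) , i

-- Choices of g(1) which, with g(0) = 0, realise all the exceptional words within the first 64
-- letters of 𝐝.
exceptionalImages : List Word
exceptionalImages
  = (𝟎 ∷ 𝟏 ∷ 𝟎 ∷ [])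
  ∷ (𝟎 ∷ 𝟏 ∷ 𝟎 ∷ 𝟏 ∷ 𝟎 ∷ 𝟏 ∷ [])
  ∷ (𝟏 ∷ 𝟎 ∷ 𝟏 ∷ 𝟎 ∷ 𝟏 ∷ 𝟎 ∷ [])
  ∷ (𝟏 ∷ 𝟎 ∷ 𝟏 ∷ 𝟎 ∷ 𝟏 ∷ [])
  ∷ []

EncounteredVia : Word → Word → Set
EncounteredVia p B = B ≢ [] × Infix _≡_ (⟪ [ 𝟎 ] , B ⟫ ⟨ p ⟩) (δ^ 6 [0])

encounteredVia? : ∀ p B → Dec (EncounteredVia p B)
encounteredVia? p B = ¬? (≡-dec _≟_ B []) ×-dec infix? _≟_ (⟪ [ 𝟎 ] , B ⟫ ⟨ p ⟩) (δ^ 6 [0])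

EncounteredVia⇒Encounters : ∀ p {B} → EncounteredVia p B → Encounters 𝐝 p
EncounteredVia⇒Encounters p {B} (≢[] , i) =
  ⟪ [ 𝟎 ] , B ⟫ , (λ { 𝟎 () ; 𝟏 → ≢[] }) , infix⇒IsFactor 6 i

exceptional-encountered : ∀ p → p ∈ exceptionalWords → Encounters 𝐝 p
exceptional-encountered p e = EncounteredVia⇒Encounters p (proj₂ (Any.satisfied (All.lookup certificates e)))
  where
  certificates : All (λ p → Any (EncounteredVia p) exceptionalImages) exceptionalWords
  certificates = toWitness {a? = All.all? (λ p → any? (encounteredVia? p) exceptionalImages) exceptionalWords} tt

Outcome⇒Encounters : ∀ p → Outcome p → Encounters 𝐝 p
Outcome⇒Encounters p (inj₁ (here c))         = FactorCondition⇒Encounters p c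
Outcome⇒Encounters p (inj₁ (there (here c))) =
  Encounters-complement p (FactorCondition⇒Encounters (complement p) c)
Outcome⇒Encounters p (inj₂ (here e))         = exceptional-encountered p e
Outcome⇒Encounters p (inj₂ (there (here e))) =
  Encounters-complement p (exceptional-encountered (complement p) e)

-- Exclusivity of the two possibilities

Refuted : Word → Set
Refuted q = All (λ g → T (absent 4 (g ⟨ q ⟩))) ([_] ∷ h₁ ∷ h₂ ∷ [])

Refuted⇒¬FactorCondition : ∀ q → Refuted q → ¬ FactorCondition q
Refuted⇒¬FactorCondition q (t ∷ _) (inj₁ i) =
  absent⇒¬Factor 4 ([_] ⟨ q ⟩) t (subst Factor (sym (concatMap-pure q)) (IsFactor⇒Factor q i))
Refuted⇒¬FactorCondition q (_ ∷ t ∷ _) (inj₂ (inj₁ i)) =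
  absent⇒¬Factor 4 (h₁ ⟨ q ⟩) t (IsFactor⇒Factor (h₁ ⟨ q ⟩) i)
Refuted⇒¬FactorCondition q (_ ∷ _ ∷ t ∷ []) (inj₂ (inj₂ i)) =
  absent⇒¬Factor 4 (h₂ ⟨ q ⟩) t (IsFactor⇒Factor (h₂ ⟨ q ⟩) i)

refuted? : ∀ q → Dec (Refuted q)
refuted? q = All.all? (λ g → T? (absent 4 (g ⟨ q ⟩))) ([_] ∷ h₁ ∷ h₂ ∷ [])

exceptional-refuted : All (λ p → Refuted p × Refuted (complement p)) exceptionalWords
exceptional-refuted =
  toWitness {a? = All.all? (λ p → refuted? p ×-dec refuted? (complement p)) exceptionalWords} tt

exceptional⇒¬Possibility₁ : ∀ {p} → p ∈ exceptionalWords → ¬ Possibility₁ p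
exceptional⇒¬Possibility₁ e (here c) =
  Refuted⇒¬FactorCondition _ (proj₁ (All.lookup exceptional-refuted e)) c
exceptional⇒¬Possibility₁ e (there (here c)) =
  Refuted⇒¬FactorCondition _ (proj₂ (All.lookup exceptional-refuted e)) c

exclusive : ∀ p → ¬ (Possibility₁ p × Possibility₂ p)
exclusive p (c , here e)         = exceptional⇒¬Possibility₁ e c
exclusive p (c , there (here e)) = exceptional⇒¬Possibility₁ e (swap-complement p c)

theorem5p3 : ∀ (p : Word) →
    (Encounters 𝐝 p ⇔ (Possibility₁ p ⊎ Possibility₂ p)) ×
    ¬ (Possibility₁ p × Possibility₂ p)
theorem5p3 p = mk⇔ (Encounters⇒Outcome p) (Outcome⇒Encounters p) , exclusive p
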